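{- Let $k \geq 0$ and $n$ be integers with $n \geq 2k$. If $\mathcal{F}$ is a locally $k$-wide family of segments of $[n]$, then $|\mathcal{F}| \leq 2kn - 2k^2 + k + 1$. This bound is best possible: for all such $k$ and $n$ there is a locally $k$-wide family of segments of $[n]$ with exactly $2kn - 2k^2 + k + 1$ members.
   Context: $[n] = \{1,2,\dots,n\}$. A segment of $[n]$ is a subset of the form $[i,j] = \{m \in \mathbf{Z} \mid i \leq m \leq j\} \subseteq [n]$; the empty set is a segment. A family $\mathcal{F}$ of subsets of a finite set $X$ is locally $k$-wide iff for every $x \in X$ every antichain (with respect to inclusion) of $\{U \in \mathcal{F} \mid x \in U\}$ has at most $k$ members. -}

module Defs where

open import Data.Fin using (Fin; toℕ)
open import Data.Fin.Subset using (Subset; _⊆_) renaming (_∈_ to _∈ˢ_)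
open import Data.List using (List; length)
open import Data.List.Membership.Propositional using () renaming (_∈_ to _∈ˡ_)
open import Data.List.Relation.Unary.Unique.Propositional using (Unique)
open import Data.Nat using (ℕ; suc; _≤_)
open import Data.Product using (_×_; ∃₂)
open import Function.Bundles using (_⇔_)
open import Relation.Binary.PropositionalEquality using (_≡_)

-- A set of subsets of a finite set is given by a duplicate-free
-- enumeration, so that the length of the list is the cardinality.
record Family (n : ℕ) : Set where
  constructor family
  field
    members  : List (Subset n)
    distinct : Unique members

open Family public

infix 4 _∈_

_∈_ : ∀ {n} → Subset n → Family n → Set
U ∈ F = U ∈ˡ members F

card : ∀ {n} → Family n → ℕ
card F = length (members F)

-- Fin n stands for [n] = {1,…,n}: x represents the integer suc (toℕ x).
-- The endpoints satisfy 1 ≤ i and j ≤ n, so that [i , j] ⊆ [n]; the empty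
-- segment arises from i > j, e.g. i = 1 and j = 0.
IsSegment : ∀ {n} → Subset n → Set
IsSegment {n} U = ∃₂ λ (i j : ℕ) → 1 ≤ i × j ≤ n ×
  (∀ (x : Fin n) → x ∈ˢ U ⇔ (i ≤ suc (toℕ x) × suc (toℕ x) ≤ j))

SegmentFamily : ∀ {n} → Family n → Set
SegmentFamily F = ∀ U → U ∈ F → IsSegment U

Antichain : ∀ {n} → Family n → Set
Antichain A = ∀ U V → U ∈ A → V ∈ A → U ⊆ V → U ≡ V

LocallyWide : ∀ {n} → ℕ → Family n → Set
LocallyWide {n} k F = ∀ (x : Fin n) (A : Family n) →
  (∀ U → U ∈ A → U ∈ F × x ∈ˢ U) → Antichain A → card A ≤ k

{-# OPTIONS --safe #-}

-- Encode the segment [i + 1 , n - c] by the cell (i , c) and, for a family F,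
-- put an arbitrary natural number on every cell of F.  The local rules of the
-- Robinson–Schensted–Knuth correspondence replace an array m by its
-- last-passage times and a derived array.  A chain of t + 1 cells of the
-- derived array (left and right ends strictly increasing, with a common point)
-- forces one of t + 2 cells of m, so for a locally k-wide family the k-th
-- derived array is zero.  Hence m can be recovered from the passage times of
-- its first k layers on the two antidiagonals i + c = n and i + c = n + 1,
-- where layer t has at most 2(n - 2t) - 1 nonzero entries, and these entries
-- grow linearly with those of m.  Counting the arrays with entries below M, for
-- M large, bounds the number of nonempty members of F by
-- Σ_{t<k} (2(n - 2t) - 1) = 2kn - 2k² + k.
-- For the converse take the empty set and all segments which have length at
-- most k or start within the first k points.
module Submission where

import Data.Bool.Properties as Bool
open import Data.Empty using (⊥-elim)
open import Data.Fin as Fin using (Fin; toℕ; fromℕ<; finToFun; funToFin; combine)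
open import Data.Fin.Properties
  using (toℕ<n; toℕ-fromℕ<; fromℕ<-injective; toℕ-injective; funToFin-finToFin; finToFun-funToFin; injective⇒≤)
open import Data.Fin.Subset using (Subset; _⊆_; _⊈_; ⊥) renaming (_∈_ to _∈ˢ_)
open import Data.Fin.Subset.Properties using (⊆-antisym; ⊆-refl; ⊆-reflexive; ∉⊥)
open import Data.List using (List; []; _∷_; _++_; length; lookup; map; upTo)
import Data.List.Membership.DecPropositional as DecMembership
open import Data.List.Membership.Propositional using () renaming (_∈_ to _∈ˡ_)
open import Data.List.Membership.Propositional.Properties
  using (∈-lookup; ∈-map⁺; ∈-map⁻; ∈-++⁺ˡ; ∈-++⁺ʳ; ∈-++⁻; ∈-upTo⁺; ∈-upTo⁻)
open import Data.List.Properties using (length-++; length-map; length-upTo)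
open import Data.List.Relation.Unary.All as All using (All; []; _∷_)
open import Data.List.Relation.Unary.AllPairs as AllPairs using (AllPairs; []; _∷_)
open import Data.List.Relation.Unary.Any using (here; there; index)
open import Data.List.Relation.Unary.Any.Properties using (lookup-index)
open import Data.List.Relation.Unary.Unique.Propositional using (Unique)
import Data.List.Relation.Unary.Unique.Propositional.Properties as Unique
open import Data.Nat
  using (ℕ; zero; suc; _+_; _*_; _∸_; _^_; _⊔_; _⊓_; _≤_; _<_; _≥_; _≤?_; _<?_; z≤n; s≤s; s≤s⁻¹)
open import Data.Nat.Properties
open import Data.Nat.Tactic.RingSolver using (solve-∀)
open import Data.Product using (_×_; _,_; proj₁; proj₂; ∃-syntax)
open import Data.Sum as Sum using (_⊎_; inj₁; inj₂; [_,_]′)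
open import Data.Vec using (tabulate)
import Data.Vec.Properties as Vec
open import Function using (_∘_)
open import Function.Bundles using (mk⇔; Equivalence)
open import Relation.Binary.Definitions using (tri<; tri≈; tri>)
open import Relation.Binary.PropositionalEquality
  using (_≡_; refl; sym; trans; cong; cong₂; subst; subst₂; _≢_; _≗_; module ≡-Reasoning)
open import Relation.Nullary using (¬_; Dec; yes; no; contradiction)
open import Relation.Nullary.Decidable using (isYes; _×-dec_; fromWitness; toWitness)
open import Defs

-- Strict inequalities with truncated subtraction

m<n∸o⇒o<n : ∀ {m n o} → m < n ∸ o → o < n
m<n∸o⇒o<n m<n∸o = m∸n≢0⇒n<m λ eq → <⇒≱ m<n∸o (≤-trans (≤-reflexive eq) z≤n)

m<n∸o⇒m+o<n : ∀ {m} n o → m < n ∸ o → m + o < n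
m<n∸o⇒m+o<n {m} n o m<n∸o = m≤o∸n⇒m+n≤o (suc m) (<⇒≤ (m<n∸o⇒o<n {n = n} {o} m<n∸o)) m<n∸o

-- Last-passage times and their local rules

Array : Set
Array = ℕ → ℕ → ℕ

passage : Array → Array
passage m zero    c       = 0
passage m (suc i) zero    = 0
passage m (suc i) (suc c) = (passage m i (suc c) ⊔ passage m (suc i) c) + m i c

-- The amount that the local rule of RSK hands on to the next part at a cell: the passage times of
-- the successive layers at `(i , c)` are the parts of the partition that the growth diagram has
-- there.
derive : Array → Array
derive m i c = (passage m i (suc c) ⊓ passage m (suc i) c) ∸ passage m i c

layer : ℕ → Array → Array
layer zero    m = m
layer (suc t) m = layer t (derive m)

passage-zeroʳ : ∀ m i → passage m i 0 ≡ 0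
passage-zeroʳ m zero    = refl
passage-zeroʳ m (suc i) = refl

passage-stepˡ : ∀ m i c → passage m i c ≤ passage m (suc i) c
passage-stepˡ m i zero    = ≤-reflexive (passage-zeroʳ m i)
passage-stepˡ m i (suc c) = ≤-trans (m≤m⊔n _ _) (m≤m+n _ (m i c))

passage-stepʳ : ∀ m i c → passage m i c ≤ passage m i (suc c)
passage-stepʳ m zero    c = z≤n
passage-stepʳ m (suc i) c = ≤-trans (m≤n⊔m (passage m i (suc c)) _) (m≤m+n _ (m i c))

step⇒mono : ∀ (f : ℕ → ℕ) → (∀ a → f a ≤ f (suc a)) → ∀ {a b} → a ≤ b → f a ≤ f b
step⇒mono f step {b = zero}  z≤n = ≤-refl
step⇒mono f step {a} {suc b} a≤1+b with m≤n⇒m<n∨m≡n a≤1+b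
... | inj₁ a<1+b = ≤-trans (step⇒mono f step (s≤s⁻¹ a<1+b)) (step b)
... | inj₂ refl  = ≤-refl

passage-mono : ∀ m {i i′ c c′} → i ≤ i′ → c ≤ c′ → passage m i c ≤ passage m i′ c′
passage-mono m {i′ = i′} {c} i≤i′ c≤c′ =
  ≤-trans (step⇒mono (λ i → passage m i c) (λ i → passage-stepˡ m i c) i≤i′)
          (step⇒mono (passage m i′) (passage-stepʳ m i′) c≤c′)

passage≤corner : ∀ m i c → passage m i c ≤ passage m i (suc c) ⊓ passage m (suc i) c
passage≤corner m i c = ⊓-glb (passage-stepʳ m i c) (passage-stepˡ m i c)

-- Corners of level sets and chains of cells

jump : ∀ (f : ℕ → ℕ) {ℓ} a → f 0 ≤ ℓ → ℓ < f a → ∃[ p ] (p < a × f p ≤ ℓ × ℓ < f (suc p))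
jump f zero f0≤ℓ ℓ<f0 = contradiction ℓ<f0 (≤⇒≯ f0≤ℓ)
jump f {ℓ} (suc a) f0≤ℓ ℓ<f1+a with f a ≤? ℓ
... | yes fa≤ℓ = a , ≤-refl , fa≤ℓ , ℓ<f1+a
... | no  fa≰ℓ with p , p<a , rest ← jump f a f0≤ℓ (≰⇒> fa≰ℓ) = p , m≤n⇒m≤1+n p<a , rest

-- A passage time exceeds the larger of its two predecessors by exactly the entry of the cell.
positive-at-jump : ∀ m {i c ℓ} → passage m i (suc c) ≤ ℓ → passage m (suc i) c ≤ ℓ →
  ℓ < passage m (suc i) (suc c) → 0 < m i c
positive-at-jump m {i} {c} ≤ˡ ≤ʳ ℓ< with m i c
... | suc _ = s≤s z≤n
... | zero  = contradiction (≤-trans ℓ< (≤-trans (≤-reflexive (+-identityʳ _)) (⊔-lub ≤ˡ ≤ʳ))) (<-irrefl refl)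

-- An inner corner (a , b) of the level set { passage m > passage m a b }; the
-- cells (p , b) and (a , q) are the outer corners adjacent to it.
record Corner (m : Array) (a b : ℕ) : Set where
  field
    p q : ℕ
    p<a : p < a
    q<b : q < b
    at-p : 0 < m p b
    at-q : 0 < m a q
    above-p : passage m a b < passage m (suc p) (suc b)
    above-q : passage m a b < passage m (suc a) (suc q)

-- Positivity puts both `(a , suc b)` and `(suc a , b)` above the level of `(a , b)`. The passage
-- times along that column and that row start at 0, so each crosses the level, and `m` is positive
-- at the crossing.
corner : ∀ m a b → 0 < derive m a b → Corner m a b
corner m a b pos = record
  { p<a = p<a ; q<b = q<b ; above-p = above-p ; above-q = above-q
  ; at-p = positive-at-jump m below-p (passage-mono m p<a (≤-refl {b})) above-p
  ; at-q = positive-at-jump m (passage-mono m (≤-refl {a}) q<b) below-q above-q }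
  where
  ℓ<⊓ : passage m a b < passage m a (suc b) ⊓ passage m (suc a) b
  ℓ<⊓ = m∸n≢0⇒n<m (λ eq → <-irrefl (sym eq) pos)

  column = jump (λ i → passage m i (suc b)) a z≤n
             (m<n⊓o⇒m<n (passage m a (suc b)) (passage m (suc a) b) ℓ<⊓)
  row    = jump (passage m (suc a)) b z≤n
             (m<n⊓o⇒m<o (passage m a (suc b)) (passage m (suc a) b) ℓ<⊓)

  p<a     = proj₁ (proj₂ column)
  below-p = proj₁ (proj₂ (proj₂ column))
  above-p = proj₂ (proj₂ (proj₂ column))
  q<b     = proj₁ (proj₂ row)
  below-q = proj₁ (proj₂ (proj₂ row))
  above-q = proj₂ (proj₂ (proj₂ row))

-- Along a chain `i` increases and `c` decreases, so both ends of the segments move right. When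
-- `top + β ≤ n`, the bounds `i ≤ top` and `c < β` put the point `top + 1` into all of them.
data Chain (m : Array) (top : ℕ) : ℕ → ℕ → ℕ → Set where
  []   : ∀ {a β} → Chain m top a β 0
  link : ∀ {a β t i c} → a ≤ i → i ≤ top → c < β → 0 < m i c →
         Chain m top (suc i) c t → Chain m top a β (suc t)

weaken : ∀ {m top a a′ β β′ t} → a′ ≤ a → β ≤ β′ → Chain m top a β t → Chain m top a′ β′ t
weaken a′≤a β≤β′ [] = []
weaken a′≤a β≤β′ (link a≤i i≤top c<β pos chain) =
  link (≤-trans a′≤a a≤i) i≤top (<-≤-trans c<β β≤β′) pos chain

-- Of two consecutive corners, the one of higher level has an outer corner that
-- lies in the level set of the other; this cell fits strictly between the two.
refine-tail : ∀ {m top a b t} → a ≤ top → Corner m a b → Chain (derive m) top (suc a) b t →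
  Chain m top a b (suc t)
refine-tail a≤top C [] = link ≤-refl a≤top (Corner.q<b C) (Corner.at-q C) []
refine-tail {m} {a = a} {b} a≤top C (link {i = i} {c} a<i i≤top c<b pos chain)
  with corner m i c pos
... | C′ with refine-tail i≤top C′ chain | passage m a b ≤? passage m i c
... | tail | yes ≤-level = link a≤p′ (≤-trans (<⇒≤ C′.p<a) i≤top) c<b C′.at-p (weaken C′.p<a ≤-refl tail)
  where
  module C′ = Corner C′
  a≤p′ : a ≤ C′.p
  a≤p′ = ≮⇒≥ λ p′<a → <⇒≱ (≤-<-trans ≤-level C′.above-p) (passage-mono m p′<a c<b)
... | tail | no ≰-level = link ≤-refl a≤top C.q<b C.at-q (weaken a<i c≤q tail)
  where
  module C = Corner C
  c≤q : c ≤ C.q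
  c≤q = ≮⇒≥ λ q<c → <⇒≱ (<-trans (≰⇒> ≰-level) C.above-q) (passage-mono m a<i q<c)

-- `refine-tail` keeps the number of cells; the extra one is the outer corner `(p , c)` of the first
-- cell, put in front.
refine : ∀ {m top β t} → Chain (derive m) top 0 β (suc t) → Chain m top 0 β (suc (suc t))
refine {m} (link {i = i} {c} _ i≤top c<β pos chain) =
  link z≤n (≤-trans (<⇒≤ (Corner.p<a C)) i≤top) c<β (Corner.at-p C)
    (weaken (Corner.p<a C) ≤-refl (refine-tail i≤top C chain))
  where C = corner m i c pos

layer-chain : ∀ k {m top β t} → Chain (layer k m) top 0 β (suc t) → Chain m top 0 β (suc (k + t))
layer-chain zero    chain = chain
layer-chain (suc k) chain = refine (layer-chain k chain)

-- A single positive cell `(i , c)` of layer `k` is a chain with `top = i` and `β = suc c`, and each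
-- of the `k` derivations undone adds a cell.
layer-vanishes : ∀ {n} k m → (∀ {top β} → top + β ≤ n → ¬ Chain m top 0 β (suc k)) →
  ∀ i c → i + c < n → layer k m i c ≡ 0
layer-vanishes k m free i c i+c<n with layer k m i c in eq
... | zero  = refl
... | suc _ = ⊥-elim (free (≤-trans (≤-reflexive (+-suc i c)) i+c<n)
                (subst (λ s → Chain m i 0 (suc c) (suc s)) (+-identityʳ k)
                  (layer-chain k (link z≤n ≤-refl ≤-refl (subst (0 <_) (sym eq) (s≤s z≤n)) []))))

-- Where the layers vanish

Low : ℕ → Array → Set
Low r m = ∀ i c → i < r ⊎ c < r → m i c ≡ 0

low-passage : ∀ {r m} → Low r m → ∀ i c → i ≤ r ⊎ c ≤ r → passage m i c ≡ 0
low-passage low zero    c       _ = refl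
low-passage low (suc i) zero    _ = refl
low-passage {r} {m} low (suc i) (suc c) i<r⊎c<r
  rewrite low i c i<r⊎c<r
        | low-passage low i (suc c) (Sum.map₁ <⇒≤ i<r⊎c<r)
        | low-passage low (suc i) c (Sum.map₂ <⇒≤ i<r⊎c<r) = refl

-- In the new row and column, one of the two passage times under the minimum is still 0.
low-derive : ∀ {r m} → Low r m → Low (suc r) (derive m)
low-derive {r} {m} low i c (inj₁ i≤r)
  rewrite low-passage low i (suc c) (inj₁ (s≤s⁻¹ i≤r)) = 0∸n≡0 (passage m i c)
low-derive {r} {m} low i c (inj₂ c≤r)
  rewrite low-passage low (suc i) c (inj₂ (s≤s⁻¹ c≤r)) | ⊓-zeroʳ (passage m i (suc c)) = 0∸n≡0 (passage m i c)

low-layer : ∀ t {r m} → Low r m → Low (t + r) (layer t m)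
low-layer zero    low = low
low-layer (suc t) {r} {m} low =
  subst (λ s → Low s (layer t (derive m))) (+-suc t r) (low-layer t (low-derive low))

boundary-low : ∀ t m i c → i ≤ t ⊎ c ≤ t → passage (layer t m) i c ≡ 0
boundary-low t m = low-passage (subst (λ s → Low s (layer t m)) (+-identityʳ t)
  (low-layer t λ { i c (inj₁ ()) ; i c (inj₂ ()) }))

-- Linear growth of the passage times

Bounded : ℕ → ℕ → Array → Set
Bounded n B m = ∀ i c → i + c < n → m i c ≤ B

-- A lattice path to `(i , c)` collects at most `i + c` entries.
bounded-passage : ∀ {n B m} → Bounded n B m → ∀ i c → i + c ≤ suc n → passage m i c ≤ (i + c) * B
bounded-passage bd zero    c       _ = z≤n
bounded-passage bd (suc i) zero    _ = z≤n
bounded-passage {n} {B} {m} bd (suc i) (suc c) i+c≤n = begin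
  (passage m i (suc c) ⊔ passage m (suc i) c) + m i c
    ≤⟨ +-mono-≤ (⊔-lub (bounded-passage bd i (suc c) (<⇒≤ i+c≤n))
         (≤-trans (bounded-passage bd (suc i) c (≤-trans (≤-reflexive (sym (+-suc i c))) (<⇒≤ i+c≤n)))
           (≤-reflexive (cong (_* B) (sym (+-suc i c))))))
         (bd i c (≤-trans (≤-reflexive (sym (+-suc i c))) (s≤s⁻¹ i+c≤n))) ⟩
  (i + suc c) * B + B ≡⟨ +-comm _ B ⟩
  (suc i + suc c) * B ∎
  where open ≤-Reasoning

bounded-passage′ : ∀ {n B m} → Bounded n B m → ∀ i c → i + c ≤ suc n → passage m i c ≤ suc n * B
bounded-passage′ {B = B} bd i c le = ≤-trans (bounded-passage bd i c le) (*-monoˡ-≤ B le)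

bounded-derive : ∀ {n B m} → Bounded n B m → Bounded n (suc n * B) (derive m)
bounded-derive {m = m} bd i c i+c<n =
  ≤-trans (m∸n≤m _ (passage m i c)) (≤-trans (m⊓n≤n _ _)
    (bounded-passage′ bd (suc i) c (m≤n⇒m≤1+n i+c<n)))

bounded-layer : ∀ t {n B m} → Bounded n B m → Bounded n (suc n ^ t * B) (layer t m)
bounded-layer zero    {B = B} bd i c lt = ≤-trans (bd i c lt) (≤-reflexive (sym (+-identityʳ B)))
bounded-layer (suc t) {n} {B} bd i c lt = ≤-trans (bounded-layer t (bounded-derive bd) i c lt)
  (≤-reflexive (trans (sym (*-assoc (suc n ^ t) (suc n) B)) (cong (_* B) (*-comm (suc n ^ t) (suc n)))))

boundary-bounded : ∀ {n B m k t} → Bounded n B m → t < k → ∀ i c → i + c ≤ suc n →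
  passage (layer t m) i c ≤ suc n ^ k * B
boundary-bounded {n} {B} {t = t} bd t<k i c le =
  ≤-trans (bounded-passage′ (bounded-layer t bd) i c le)
    (≤-trans (≤-reflexive (sym (*-assoc (suc n) (suc n ^ t) B))) (*-monoˡ-≤ B (^-monoʳ-≤ (suc n) t<k)))

-- Inverting the local rules

SameBelow : ℕ → Array → Array → Set
SameBelow n m m̃ = ∀ i c → i + c < n → m i c ≡ m̃ i c

-- The derived arrays are compared only for `i + c < n`, so passage times on antidiagonal `n` must
-- be given; those on `n + 1` determine the entries of `m` with `i + c + 1 = n`.
SameBoundary : ℕ → Array → Array → Set
SameBoundary n m m̃ = ∀ i c → i + c ≡ n ⊎ i + c ≡ suc n → passage m i c ≡ passage m̃ i c

passage-from-corner : ∀ m i c →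
  (passage m i (suc c) ⊓ passage m (suc i) c) ∸ derive m i c ≡ passage m i c
passage-from-corner m i c = m∸[m∸n]≡n (passage≤corner m i c)

-- The local rule run backwards from the boundary, by induction on the distance `d` to antidiagonal
-- `n + 1`.
same-passage : ∀ {n m m̃} → SameBelow n (derive m) (derive m̃) → SameBoundary n m m̃ →
  ∀ d i c → i + c + d ≡ suc n → passage m i c ≡ passage m̃ i c
same-passage same bdry zero          i c eq = bdry i c (inj₂ (trans (sym (+-identityʳ _)) eq))
same-passage same bdry (suc zero)    i c eq =
  bdry i c (inj₁ (suc-injective (trans (sym (+-comm (i + c) 1)) eq)))
same-passage {n} {m} {m̃} same bdry (suc (suc d)) i c eq = begin
  passage m i c
    ≡⟨ passage-from-corner m i c ⟨
  (passage m i (suc c) ⊓ passage m (suc i) c) ∸ derive m i c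
    ≡⟨ cong₂ _∸_ (cong₂ _⊓_ (same-passage same bdry (suc d) i (suc c) eqʳ)
                            (same-passage same bdry (suc d) (suc i) c eqˡ))
                 (same i c i+c<n) ⟩
  (passage m̃ i (suc c) ⊓ passage m̃ (suc i) c) ∸ derive m̃ i c
    ≡⟨ passage-from-corner m̃ i c ⟩
  passage m̃ i c ∎
  where
  open ≡-Reasoning
  eqˡ : suc (i + c) + suc d ≡ suc n
  eqˡ = trans (sym (+-suc (i + c) (suc d))) eq
  eqʳ : i + suc c + suc d ≡ suc n
  eqʳ = trans (cong (_+ suc d) (+-suc i c)) eqˡ
  i+c<n : i + c < n
  i+c<n = s≤s⁻¹ (≤-trans (m≤m+n (suc (suc (i + c))) d)
    (≤-reflexive (trans (cong suc (sym (+-suc (i + c) d))) eqˡ)))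

same-array : ∀ {n m m̃} → SameBelow n (derive m) (derive m̃) → SameBoundary n m m̃ → SameBelow n m m̃
same-array {n} {m} {m̃} same bdry i c i+c<n = begin
  m i c
    ≡⟨ m+n∸m≡n (previous m) (m i c) ⟨
  passage m (suc i) (suc c) ∸ previous m
    ≡⟨ cong₂ _∸_ (at (suc i) (suc c) ≤₂)
         (cong₂ _⊔_ (at i (suc c) (≤-trans (n≤1+n _) ≤₂)) (at (suc i) c (m≤n⇒m≤1+n i+c<n))) ⟩
  passage m̃ (suc i) (suc c) ∸ previous m̃
    ≡⟨ m+n∸m≡n (previous m̃) (m̃ i c) ⟩
  m̃ i c ∎
  where
  open ≡-Reasoning
  previous : Array → ℕ
  previous m = passage m i (suc c) ⊔ passage m (suc i) c
  ≤₂ : suc i + suc c ≤ suc n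
  ≤₂ = s≤s (≤-trans (≤-reflexive (+-suc i c)) i+c<n)
  at : ∀ i c → i + c ≤ suc n → passage m i c ≡ passage m̃ i c
  at i c le = same-passage same bdry (suc n ∸ (i + c)) i c (m+[n∸m]≡n le)

-- Starting from the vanishing layer `k`, each step recovers an array from its derived array and its
-- own boundary values.
reconstruct : ∀ {n} k {m m̃} →
  (∀ i c → i + c < n → layer k m i c ≡ 0) → (∀ i c → i + c < n → layer k m̃ i c ≡ 0) →
  (∀ {t} → t < k → SameBoundary n (layer t m) (layer t m̃)) → SameBelow n m m̃
reconstruct zero    van vañ bdry i c lt = trans (van i c lt) (sym (vañ i c lt))
reconstruct (suc k) van vañ bdry =
  same-array (reconstruct k van vañ (λ t<k → bdry (s≤s t<k))) (bdry (s≤s z≤n))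

-- Counting by separating observables

funToFin-cong : ∀ {m n} {f g : Fin m → Fin n} → f ≗ g → funToFin f ≡ funToFin g
funToFin-cong {zero}  f≗g = refl
funToFin-cong {suc m} f≗g = cong₂ combine (f≗g Fin.zero) (funToFin-cong (f≗g ∘ Fin.suc))

-- The tuple of observed values determines the function. Functions are coded by numbers in
-- `Fin (M ^ e)`, which turns pointwise equality into equality.
separate : ∀ {e M B} (obs : List ((Fin e → Fin M) → ℕ)) →
  (∀ f {o} → o ∈ˡ obs → o f < B) →
  (∀ f g → (∀ {o} → o ∈ˡ obs → o f ≡ o g) → f ≗ g) →
  M ^ e ≤ B ^ length obs
separate {e} {M} {B} obs bounded separating = injective⇒≤ {f = code} code-injective
  where
  decode : Fin (M ^ e) → Fin e → Fin M
  decode = finToFun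

  values : Fin (M ^ e) → Fin (length obs) → Fin B
  values a p = fromℕ< (bounded (decode a) (∈-lookup p))

  code : Fin (M ^ e) → Fin (B ^ length obs)
  code a = funToFin (values a)

  values-agree : ∀ {a b} → code a ≡ code b → ∀ p →
    lookup obs p (decode a) ≡ lookup obs p (decode b)
  values-agree {a} {b} eq p = fromℕ<-injective _ _ _ _ (begin
    values a p                       ≡⟨ finToFun-funToFin (values a) p ⟨
    finToFun (code a) p              ≡⟨ cong (λ s → finToFun s p) eq ⟩
    finToFun (code b) p              ≡⟨ finToFun-funToFin (values b) p ⟩
    values b p                       ∎)
    where open ≡-Reasoning

  code-injective : ∀ {a b} → code a ≡ code b → a ≡ b
  code-injective {a} {b} eq = begin
    a                    ≡⟨ funToFin-finToFin {e} {M} a ⟨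
    funToFin (decode a)  ≡⟨ funToFin-cong (separating _ _ λ {o} o∈ →
                              subst (λ o → o (decode a) ≡ o (decode b)) (sym (lookup-index o∈))
                                (values-agree eq (index o∈))) ⟩
    funToFin (decode b)  ≡⟨ funToFin-finToFin {e} {M} b ⟩
    b                    ∎
    where open ≡-Reasoning

^-distribʳ-* : ∀ a b p → (a * b) ^ p ≡ a ^ p * b ^ p
^-distribʳ-* a b zero    = refl
^-distribʳ-* a b (suc p) = trans (cong (a * b *_) (^-distribʳ-* a b p)) ([m*n]*[o*p]≡[m*o]*[n*p] a b (a ^ p) (b ^ p))

polynomial-growth : ∀ {C e P} → (∀ M → M ^ e ≤ suc (C * M) ^ P) → e ≤ P
polynomial-growth {C} {e} {P} growth = ≮⇒≥ λ P<e → <-irrefl refl (*-cancelʳ-≤ M D (M ^ P) {{m^n≢0 M P}} (begin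
  M ^ suc P        ≤⟨ ^-monoʳ-≤ M P<e ⟩
  M ^ e            ≤⟨ growth M ⟩
  suc (C * M) ^ P  ≤⟨ ^-monoˡ-≤ P (s≤s (m≤n+m (C * M) D)) ⟩
  (suc C * M) ^ P  ≡⟨ ^-distribʳ-* (suc C) M P ⟩
  D * M ^ P        ∎))
  where
  open ≤-Reasoning
  D = suc C ^ P
  -- Cancelling `M ^ P` would leave `M ≤ D`; this is the least `M` for which that fails.
  M = suc D

Unique⇒lookup-injective : ∀ {A : Set} {xs : List A} → Unique xs → ∀ {p q} → lookup xs p ≡ lookup xs q → p ≡ q
Unique⇒lookup-injective (x∉ ∷ u) {Fin.zero}  {Fin.zero}  eq = refl
Unique⇒lookup-injective (x∉ ∷ u) {Fin.zero}  {Fin.suc q} eq = contradiction eq (All.lookup x∉ (∈-lookup q))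
Unique⇒lookup-injective (x∉ ∷ u) {Fin.suc p} {Fin.zero}  eq = contradiction (sym eq) (All.lookup x∉ (∈-lookup p))
Unique⇒lookup-injective (x∉ ∷ u) {Fin.suc p} {Fin.suc q} eq = cong Fin.suc (Unique⇒lookup-injective u eq)

Unique-map : ∀ {A B : Set} (f : A → B) {xs} → (∀ {x y} → x ∈ˡ xs → y ∈ˡ xs → f x ≡ f y → x ≡ y) →
  Unique xs → Unique (map f xs)
Unique-map f inj []       = []
Unique-map f {x ∷ xs} inj (x∉ ∷ u) = All.tabulate ∉-map ∷ Unique-map f (λ x∈ y∈ → inj (there x∈) (there y∈)) u
  where
  ∉-map : ∀ {b} → b ∈ˡ map f xs → f x ≢ b
  ∉-map b∈ eq with y , y∈ , refl ← ∈-map⁻ f b∈ = All.lookup x∉ y∈ (inj (here refl) (there y∈) eq)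

-- Segments as cells

-- The cell (i , c) encodes the segment [i + 1 , n - c].
segment? : ∀ {n} i c (x : Fin n) → Dec (i ≤ toℕ x × toℕ x + c < n)
segment? {n} i c x = i ≤? toℕ x ×-dec toℕ x + c <? n

segment : ∀ {n} → ℕ → ℕ → Subset n
segment i c = tabulate (isYes ∘ segment? i c)

∈-segment⁺ : ∀ {n i c} {x : Fin n} → i ≤ toℕ x → toℕ x + c < n → x ∈ˢ segment i c
∈-segment⁺ {i = i} {c} {x} i≤x x+c<n = Vec.lookup⇒[]= x _
  (trans (Vec.lookup∘tabulate _ x) (Equivalence.to Bool.T-≡ (fromWitness {a? = segment? i c x} (i≤x , x+c<n))))

∈-segment⁻ : ∀ {n i c} {x : Fin n} → x ∈ˢ segment i c → i ≤ toℕ x × toℕ x + c < n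
∈-segment⁻ {i = i} {c} {x} x∈ = toWitness {a? = segment? i c x} (Equivalence.from Bool.T-≡
  (trans (sym (Vec.lookup∘tabulate (isYes ∘ segment? i c) x)) (Vec.[]=⇒lookup x∈)))

-- The left end of the first segment is missing from the second.
⊈-segment-row : ∀ {n i c i′ c′} → i + c < n → i < i′ → segment {n} i c ⊈ segment i′ c′
⊈-segment-row {n} {i} {c} {i′} {c′} i+c<n i<i′ sub =
  <⇒≱ i<i′ (subst (i′ ≤_) toℕ-x (proj₁ (∈-segment⁻ {i = i′} {c′} (sub x∈))))
  where
  i<n = ≤-<-trans (m≤m+n i c) i+c<n
  toℕ-x = toℕ-fromℕ< i<n
  x∈ : fromℕ< i<n ∈ˢ segment i c
  x∈ = ∈-segment⁺ (≤-reflexive (sym toℕ-x)) (subst (λ a → a + c < n) (sym toℕ-x) i+c<n)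

⊈-segment-column : ∀ {n i c i′ c′} → i + c < n → c < c′ → segment {n} i c ⊈ segment i′ c′
⊈-segment-column {n} {i} {c} {i′} {c′} i+c<n c<c′ sub =
  <-irrefl refl (<-≤-trans (subst (λ a → a + c′ < n) toℕ-x (proj₂ (∈-segment⁻ {i = i′} {c′} (sub x∈))))
    (≤-trans (≤-reflexive (sym last+c≡n)) (+-monoʳ-≤ last c<c′)))
  where
  -- The right end `n - c`, counted from 0.
  last = n ∸ suc c
  last+c≡n : last + suc c ≡ n
  last+c≡n = m∸n+n≡m (≤-trans (s≤s (m≤n+m c i)) i+c<n)
  last<n : last < n
  last<n = ≤-trans (s≤s (m≤m+n last c)) (≤-reflexive (trans (sym (+-suc last c)) last+c≡n))
  toℕ-x = toℕ-fromℕ< last<n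
  x∈ : fromℕ< last<n ∈ˢ segment i c
  x∈ = ∈-segment⁺
    (subst (i ≤_) (sym toℕ-x) (m+n≤o⇒m≤o∸n i (≤-trans (≤-reflexive (+-suc i c)) i+c<n)))
    (subst (λ a → a + c < n) (sym toℕ-x) (≤-reflexive (trans (sym (+-suc last c)) last+c≡n)))

segment-injective : ∀ {n i c i′ c′} → i + c < n → i′ + c′ < n →
  segment {n} i c ≡ segment i′ c′ → i ≡ i′ × c ≡ c′
segment-injective {n} {i} {c} {i′} {c′} lt lt′ eq =
  ≤-antisym (≮⇒≥ λ i′<i → ⊈-segment-row lt′ i′<i (⊆-reflexive (sym eq)))
            (≮⇒≥ λ i<i′ → ⊈-segment-row lt i<i′ (⊆-reflexive eq)) ,
  ≤-antisym (≮⇒≥ λ c′<c → ⊈-segment-column lt′ c′<c (⊆-reflexive (sym eq)))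
            (≮⇒≥ λ c<c′ → ⊈-segment-column lt c<c′ (⊆-reflexive eq))

empty-segment : ∀ {n i c} → n ≤ i + c → segment {n} i c ≡ ⊥
empty-segment {n} {i} {c} n≤i+c = ⊆-antisym sub (λ x∈ → contradiction x∈ ∉⊥)
  where
  sub : segment {n} i c ⊆ ⊥
  sub x∈ with i≤x , x+c<n ← ∈-segment⁻ {i = i} {c} x∈ =
    contradiction (≤-trans n≤i+c (+-monoˡ-≤ c i≤x)) (<⇒≱ x+c<n)

segment-IsSegment : ∀ {n} i c → IsSegment (segment {n} i c)
segment-IsSegment {n} i c = suc i , n ∸ c , s≤s z≤n , m∸n≤m n c , λ x → mk⇔
  (λ x∈ → let i≤x , x+c<n = ∈-segment⁻ {i = i} {c} x∈ in s≤s i≤x , m+n≤o⇒m≤o∸n (suc (toℕ x)) x+c<n)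
  (λ (i<x+1 , x<n∸c) → ∈-segment⁺ (s≤s⁻¹ i<x+1) (m<n∸o⇒m+o<n n c x<n∸c))

IsSegment-segment : ∀ {n} {U : Subset n} → IsSegment U → ∃[ i ] ∃[ c ] U ≡ segment i c
IsSegment-segment {n} {U} (suc i , j , _ , j≤n , U⇔) = i , n ∸ j , ⊆-antisym U⊆ ⊆U
  where
  U⊆ : U ⊆ segment i (n ∸ j)
  U⊆ {x} x∈ with i<x+1 , x<j ← Equivalence.to (U⇔ x) x∈ =
    ∈-segment⁺ (s≤s⁻¹ i<x+1) (≤-trans (+-monoˡ-≤ (n ∸ j) x<j) (≤-reflexive (m+[n∸m]≡n j≤n)))
  ⊆U : segment i (n ∸ j) ⊆ U
  ⊆U {x} x∈ with i≤x , x+c<n ← ∈-segment⁻ {i = i} {n ∸ j} x∈ =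
    Equivalence.from (U⇔ x) (s≤s i≤x ,
      +-cancelʳ-≤ (n ∸ j) _ _ (≤-trans x+c<n (≤-reflexive (sym (m+[n∸m]≡n j≤n)))))

-- The upper bound

Incomparable : ∀ {n} → Subset n → Subset n → Set
Incomparable U V = U ⊈ V × V ⊈ U

incomparable⇒Unique : ∀ {n} {Us : List (Subset n)} → AllPairs Incomparable Us → Unique Us
incomparable⇒Unique = AllPairs.map λ { (U⊈V , _) refl → U⊈V ⊆-refl }

incomparable⇒antichain : ∀ {n} {Us : List (Subset n)} → AllPairs Incomparable Us →
  ∀ U V → U ∈ˡ Us → V ∈ˡ Us → U ⊆ V → U ≡ V
incomparable⇒antichain (inc ∷ incs) U V (here refl) (here refl) U⊆V = refl
incomparable⇒antichain (inc ∷ incs) U V (here refl) (there V∈)  U⊆V = ⊥-elim (proj₁ (All.lookup inc V∈) U⊆V)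
incomparable⇒antichain (inc ∷ incs) U V (there U∈)  (here refl) U⊆V = ⊥-elim (proj₂ (All.lookup inc U∈) U⊆V)
incomparable⇒antichain (inc ∷ incs) U V (there U∈)  (there V∈)  U⊆V = incomparable⇒antichain incs U V U∈ V∈ U⊆V

record Within (n : ℕ) (m : Array) (top a β : ℕ) (U : Subset n) : Set where
  constructor within
  field
    {i c} : ℕ
    a≤i   : a ≤ i
    i≤top : i ≤ top
    c<β   : c < β
    pos   : 0 < m i c
    cell  : U ≡ segment i c

-- `Within` hands the bounds set by the head down to every later cell, so links between neighbours
-- yield pairwise incomparability.
chain-segments : ∀ {n m top a β t} → top + β ≤ n → Chain m top a β t →
  ∃[ Us ] (length Us ≡ t × All (Within n m top a β) Us × AllPairs Incomparable Us)
chain-segments fits [] = [] , refl , [] , []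
chain-segments {n} {m} {top} {a} {β} fits (link {i = i} {c} a≤i i≤top c<β pos chain)
  with Us , len , all , inc ← chain-segments (≤-trans (+-monoʳ-≤ top (<⇒≤ c<β)) fits) chain =
  segment i c ∷ Us , cong suc len ,
  within a≤i i≤top c<β pos refl ∷ All.map loosen all ,
  All.map head-incomparable all ∷ inc
  where
  fit : ∀ {i c} → i ≤ top → c < β → i + c < n
  fit {i} {c} i≤top c<β = ≤-trans (≤-trans (≤-reflexive (sym (+-suc i c))) (+-mono-≤ i≤top c<β)) fits
  loosen : ∀ {U} → Within n m top (suc i) c U → Within n m top a β U
  loosen (within i<j j≤top d<c p eq) = within (≤-trans a≤i (<⇒≤ i<j)) j≤top (<-trans d<c c<β) p eq
  head-incomparable : ∀ {U} → Within n m top (suc i) c U → Incomparable (segment i c) U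
  head-incomparable (within {j} {d} i<j j≤top d<c p refl) =
    ⊈-segment-row {c = c} {c′ = d} (fit i≤top c<β) i<j ,
    ⊈-segment-column {i = j} {i′ = i} (fit j≤top (<-trans d<c c<β)) d<c

fill : ∀ {n} → (Subset n → ℕ) → Array
fill w i c = w (segment i c)

-- The segments of such a chain would be `k + 1` pairwise incomparable members of `F` through one
-- point.
wide⇒chain-free : ∀ {n k top β} (F : Family n) (w : Subset n → ℕ) → (∀ U → 0 < w U → U ∈ F) →
  LocallyWide k F → top + β ≤ n → ¬ Chain (fill w) top 0 β (suc k)
wide⇒chain-free {n} {k} {top} {β} F w support wide fits chain@(link _ _ c<β _ _)
  with Us , len , all , inc ← chain-segments fits chain =
  <-irrefl refl (subst (_≤ k) len
    (wide x (family Us (incomparable⇒Unique inc)) member (incomparable⇒antichain inc)))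
  where
  top<n : top < n
  top<n = ≤-trans (≤-trans (≤-reflexive (+-comm 1 top)) (+-monoʳ-≤ top (≤-trans (s≤s z≤n) c<β))) fits
  -- The common point `top + 1`; it lies in [n] because a nonempty chain forces `β` to be positive.
  x = fromℕ< top<n
  toℕ-x = toℕ-fromℕ< top<n
  member : ∀ U → U ∈ˡ Us → U ∈ F × x ∈ˢ U
  member U U∈ with All.lookup all U∈
  ... | within {i} {c} _ i≤top c<β pos refl =
    support _ pos ,
    ∈-segment⁺ (subst (i ≤_) (sym toℕ-x) i≤top)
      (subst (λ s → s + c < n) (sym toℕ-x)
        (≤-trans (≤-trans (≤-reflexive (sym (+-suc top c))) (+-monoʳ-≤ top c<β)) fits))

-- Positions (t , i , c) with i + c = s at which passage (layer t m) can be nonzero.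
antidiagonal : ℕ → ℕ → List (ℕ × ℕ × ℕ)
antidiagonal s t = map (λ d → t , suc t + d , s ∸ (suc t + d)) (upTo (s ∸ suc (t + t)))

boundary : ℕ → ℕ → List (ℕ × ℕ × ℕ)
boundary n zero    = []
boundary n (suc t) = antidiagonal (suc n) t ++ antidiagonal n t ++ boundary n t

∈-antidiagonal⁺ : ∀ {s t i c} → i + c ≡ s → t < i → t < c → (t , i , c) ∈ˡ antidiagonal s t
∈-antidiagonal⁺ {s} {t} {i} {c} refl t<i t<c =
  subst (_∈ˡ antidiagonal (i + c) t)
    (cong (t ,_) (cong₂ _,_ (m+[n∸m]≡n t<i) (trans (cong (i + c ∸_) (m+[n∸m]≡n t<i)) (m+n∸m≡n i c))))
    (∈-map⁺ _ (∈-upTo⁺ (m+n≤o⇒m≤o∸n (suc d) (begin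
      suc d + suc (t + t)  ≡⟨ regroup d t ⟩
      (suc t + d) + suc t  ≡⟨ cong (_+ suc t) (m+[n∸m]≡n t<i) ⟩
      i + suc t            ≤⟨ +-monoʳ-≤ i t<c ⟩
      i + c                ∎))))
  where
  open ≤-Reasoning
  d = i ∸ suc t
  regroup : ∀ d t → suc d + suc (t + t) ≡ (suc t + d) + suc t
  regroup = solve-∀

∈-antidiagonal⁻ : ∀ {s t u i c} → (u , i , c) ∈ˡ antidiagonal s t → u ≡ t × i + c ≡ s
∈-antidiagonal⁻ {s} {t} b∈ with d , d∈ , refl ← ∈-map⁻ _ b∈ =
  refl , m+[n∸m]≡n (begin
    suc t + d        ≡⟨ cong suc (+-comm t d) ⟩
    suc d + t        ≤⟨ +-monoʳ-≤ (suc d) (≤-trans (m≤m+n t t) (n≤1+n _)) ⟩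
    suc d + suc (t + t) ≤⟨ m<n∸o⇒m+o<n s (suc (t + t)) (∈-upTo⁻ d∈) ⟩
    s                ∎)
  where
  open ≤-Reasoning

∈-boundary⁺ : ∀ {n k t i c} → t < k → i + c ≡ n ⊎ i + c ≡ suc n → t < i → t < c →
  (t , i , c) ∈ˡ boundary n k
∈-boundary⁺ {n} {suc k} {t} t<k sum t<i t<c with m≤n⇒m<n∨m≡n (s≤s⁻¹ t<k)
... | inj₁ t<k′ = ∈-++⁺ʳ (antidiagonal (suc n) k) (∈-++⁺ʳ (antidiagonal n k) (∈-boundary⁺ t<k′ sum t<i t<c))
∈-boundary⁺ {n} {suc k} {t} t<k (inj₁ sum) t<i t<c | inj₂ refl =
  ∈-++⁺ʳ (antidiagonal (suc n) k) (∈-++⁺ˡ (∈-antidiagonal⁺ sum t<i t<c))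
∈-boundary⁺ {n} {suc k} {t} t<k (inj₂ sum) t<i t<c | inj₂ refl = ∈-++⁺ˡ (∈-antidiagonal⁺ sum t<i t<c)

∈-boundary⁻ : ∀ {n} k {t i c} → (t , i , c) ∈ˡ boundary n k → t < k × i + c ≤ suc n
∈-boundary⁻ {n} (suc k) b∈ with ∈-++⁻ (antidiagonal (suc n) k) b∈
... | inj₁ b∈₁ with refl , sum ← ∈-antidiagonal⁻ {suc n} {k} b∈₁ = ≤-refl , ≤-reflexive sum
... | inj₂ b∈₂ with ∈-++⁻ (antidiagonal n k) b∈₂
...   | inj₁ b∈₃ with refl , sum ← ∈-antidiagonal⁻ {n} {k} b∈₃ = ≤-refl , ≤-trans (≤-reflexive sum) (n≤1+n n)
...   | inj₂ b∈₄ with t<k , le ← ∈-boundary⁻ k b∈₄ = m≤n⇒m≤1+n t<k , le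

length-map-upTo : ∀ {A : Set} (f : ℕ → A) a → length (map f (upTo a)) ≡ a
length-map-upTo f a = trans (length-map f (upTo a)) (length-upTo a)

-- Layer `t` contributes `n - 2t` positions on antidiagonal `n + 1` and one fewer on `n`. The
-- quadratic term stands on the left to avoid truncated subtraction.
length-boundary : ∀ {n} t → t + t ≤ n → length (boundary n t) + 2 * (t * t) ≡ 2 * t * n + t
length-boundary zero    _ = refl
length-boundary {n} (suc t) 2t+2≤n
  -- With `r = n - 2t - 2` the two new antidiagonals have lengths `2 + r` and `1 + r`.
  with r , refl ← m≤n⇒∃[o]m+o≡n 2t+2≤n = begin
  length (antidiagonal (suc n) t ++ antidiagonal n t ++ boundary n t) + 2 * (suc t * suc t)
    ≡⟨ cong (_+ 2 * (suc t * suc t)) (trans (length-++ (antidiagonal (suc n) t))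
         (cong₂ _+_ (trans (length-map-upTo _ (n ∸ (t + t)))
                      (trans (cong (_∸ (t + t)) (shift₂ t r)) (m+n∸m≡n (t + t) (2 + r))))
           (trans (length-++ (antidiagonal n t)) (cong (_+ rest) (trans (length-map-upTo _ (n ∸ suc (t + t)))
             (trans (cong (_∸ suc (t + t)) (shift₁ t r)) (m+n∸m≡n (suc (t + t)) (1 + r)))))))) ⟩
  (2 + r) + ((1 + r) + rest) + 2 * (suc t * suc t)
    ≡⟨ regroup t r rest ⟩
  (rest + 2 * (t * t)) + (2 * r + 4 * t + 5)
    ≡⟨ cong (_+ (2 * r + 4 * t + 5)) (length-boundary t (≤-trans (+-mono-≤ (n≤1+n t) (n≤1+n t)) 2t+2≤n)) ⟩
  (2 * t * n + t) + (2 * r + 4 * t + 5)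
    ≡⟨ total t r ⟩
  2 * suc t * n + suc t ∎
  where
  open ≡-Reasoning
  rest = length (boundary n t)
  shift₁ : ∀ t r → suc t + suc t + r ≡ suc (t + t) + (1 + r)
  shift₁ = solve-∀
  shift₂ : ∀ t r → suc t + suc t + r ≡ (t + t) + (2 + r)
  shift₂ = solve-∀
  regroup : ∀ t r l → (2 + r) + ((1 + r) + l) + 2 * (suc t * suc t) ≡ (l + 2 * (t * t)) + (2 * r + 4 * t + 5)
  regroup = solve-∀
  total : ∀ t r → (2 * t * (suc t + suc t + r) + t) + (2 * r + 4 * t + 5) ≡ 2 * suc t * (suc t + suc t + r) + suc t
  total = solve-∀

-- Weights on a family and their observables

module _ {n : ℕ} (F : Family n) where

  open DecMembership (Vec.≡-dec {n = n} Bool._≟_) using (_∈?_)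

  weight : ∀ {M} → (Fin (card F) → Fin M) → Subset n → ℕ
  weight f U with U ∈? members F
  ... | yes U∈ = toℕ (f (index U∈))
  -- The default 0 keeps all positive cells inside `F`, so that chains consist of members.
  ... | no  _  = 0

  weight-support : ∀ {M} (f : Fin (card F) → Fin M) U → 0 < weight f U → U ∈ F
  weight-support f U pos with U ∈? members F
  ... | yes U∈ = U∈

  weight≤ : ∀ {M} (f : Fin (card F) → Fin M) U → weight f U ≤ M
  weight≤ f U with U ∈? members F
  ... | yes U∈ = <⇒≤ (toℕ<n (f (index U∈)))
  ... | no  _  = z≤n

  weight-lookup : ∀ {M} (f : Fin (card F) → Fin M) p → weight f (lookup (members F) p) ≡ toℕ (f p)
  weight-lookup f p with lookup (members F) p ∈? members F
  ... | yes U∈ = cong (toℕ ∘ f) (sym (Unique⇒lookup-injective (distinct F) (lookup-index U∈)))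
  ... | no U∉  = contradiction (∈-lookup p) U∉

  module _ {k : ℕ} (segments : SegmentFamily F) (wide : LocallyWide k F) where

    observe : ∀ {M} → ℕ × ℕ × ℕ → (Fin (card F) → Fin M) → ℕ
    observe (t , i , c) f = passage (layer t (fill (weight f))) i c

    -- The empty set is no cell with `i + c < n`, so its weight is observed separately; this is the
    -- final `+ 1` of the bound.
    observables : ∀ {M} → List ((Fin (card F) → Fin M) → ℕ)
    observables = (λ f → weight f ⊥) ∷ map observe (boundary n k)

    observables-bounded : ∀ {M} (f : Fin (card F) → Fin M) {o} → o ∈ˡ observables → o f < suc (suc n ^ k * M)
    observables-bounded {M} f (here refl) =
      s≤s (≤-trans (weight≤ f ⊥) (≤-trans (≤-reflexive (sym (*-identityˡ M))) (*-monoˡ-≤ M (m^n>0 (suc n) k))))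
    observables-bounded f (there o∈) with (t , i , c) , b∈ , refl ← ∈-map⁻ observe o∈
      with t<k , sum ← ∈-boundary⁻ k b∈ =
      s≤s (boundary-bounded (λ i c _ → weight≤ f (segment i c)) t<k i c sum)

    -- The boundary values that are not observed are 0 for both weights, so `reconstruct` applies.
    observables-separating : ∀ {M} (f g : Fin (card F) → Fin M) →
      (∀ {o} → o ∈ˡ observables → o f ≡ o g) → f ≗ g
    observables-separating f g same p = toℕ-injective (begin
      toℕ (f p)                          ≡⟨ weight-lookup f p ⟨
      weight f (lookup (members F) p)    ≡⟨ same-weight _ (segments _ (∈-lookup p)) ⟩
      weight g (lookup (members F) p)    ≡⟨ weight-lookup g p ⟩
      toℕ (g p)                          ∎)
      where
      open ≡-Reasoning
      vanishes : ∀ h i c → i + c < n → layer k (fill (weight h)) i c ≡ 0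
      vanishes h = layer-vanishes k (fill (weight h)) (wide⇒chain-free F (weight h) (weight-support h) wide)

      both-zero : ∀ {t i c} → i ≤ t ⊎ c ≤ t →
        passage (layer t (fill (weight f))) i c ≡ passage (layer t (fill (weight g))) i c
      both-zero {t} {i} {c} low = trans (boundary-low t _ i c low) (sym (boundary-low t _ i c low))

      same-boundary : ∀ {t} → t < k → SameBoundary n (layer t (fill (weight f))) (layer t (fill (weight g)))
      same-boundary {t} t<k i c sum with t <? i | t <? c
      ... | yes t<i | yes t<c = same (there (∈-map⁺ observe (∈-boundary⁺ t<k sum t<i t<c)))
      ... | no t≮i  | _       = both-zero {t} {i} {c} (inj₁ (≮⇒≥ t≮i))
      ... | yes _   | no t≮c  = both-zero {t} {i} {c} (inj₂ (≮⇒≥ t≮c))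

      same-fill : SameBelow n (fill (weight f)) (fill (weight g))
      same-fill = reconstruct k (vanishes f) (vanishes g) same-boundary

      same-weight : ∀ U → IsSegment U → weight f U ≡ weight g U
      same-weight U seg with i , c , refl ← IsSegment-segment seg with i + c <? n
      ... | yes i+c<n = same-fill i c i+c<n
      ... | no  i+c≮n = subst (λ V → weight f V ≡ weight g V) (sym (empty-segment {i = i} {c} (≮⇒≥ i+c≮n))) (same (here refl))

    -- The values are bounded linearly in `M`, with a factor `suc n ^ k` independent of `M`, so the
    -- exponents can be compared.
    card≤observables : card F ≤ suc (length (boundary n k))
    card≤observables = polynomial-growth {suc n ^ k} λ M →
      subst (λ l → M ^ card F ≤ suc (suc n ^ k * M) ^ l) (cong suc (length-map (observe {M}) (boundary n k)))
        (separate observables observables-bounded observables-separating)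

-- An extremal family

row : ℕ → ℕ → List (ℕ × ℕ)
row n t = map (t ,_) (upTo (n ∸ t))

-- The segments of length t + 1 with left end beyond the first k points.
diagonal : ℕ → ℕ → ℕ → List (ℕ × ℕ)
diagonal n k t = map (λ c → n ∸ suc (t + c) , c) (upTo (n ∸ (t + k)))

cells : ℕ → ℕ → ℕ → List (ℕ × ℕ)
cells n k zero    = []
cells n k (suc t) = row n t ++ diagonal n k t ++ cells n k t

∈-row⁻ : ∀ {n t i c} → (i , c) ∈ˡ row n t → i ≡ t × i + c < n
∈-row⁻ {n} {t} ∈row with c , c∈ , refl ← ∈-map⁻ (t ,_) ∈row =
  refl , ≤-trans (≤-reflexive (cong suc (+-comm t c))) (m<n∸o⇒m+o<n n t (∈-upTo⁻ c∈))

∈-diagonal⁻ : ∀ {n k t i c} → (i , c) ∈ˡ diagonal n k t → k ≤ i × suc t + (i + c) ≡ n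
∈-diagonal⁻ {n} {k} {t} ∈diag with c , c∈ , refl ← ∈-map⁻ (λ c → n ∸ suc (t + c) , c) ∈diag =
  m+n≤o⇒m≤o∸n k (≤-trans (≤-reflexive (regroup k t c)) c+t+k<n) ,
  trans (regroup′ t (n ∸ suc (t + c)) c) (m+[n∸m]≡n t+c<n)
  where
  regroup : ∀ k t c → k + suc (t + c) ≡ suc c + (t + k)
  regroup = solve-∀
  regroup′ : ∀ t i c → suc t + (i + c) ≡ suc (t + c) + i
  regroup′ = solve-∀
  c+t+k<n : suc c + (t + k) ≤ n
  c+t+k<n = m<n∸o⇒m+o<n n (t + k) (∈-upTo⁻ c∈)
  t+c<n : suc (t + c) ≤ n
  t+c<n = ≤-trans (m≤n+m _ k) (≤-trans (≤-reflexive (regroup k t c)) c+t+k<n)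

-- The segment of `(i , c)` has `n - (i + c)` points, so the last inequality says that its length is
-- at most `t`.
∈-cells⁻ : ∀ {n k} t {i c} → (i , c) ∈ˡ cells n k t →
  i + c < n × (i < t ⊎ k ≤ i × n ≤ t + (i + c))
∈-cells⁻ {n} {k} (suc t) ∈cells with ∈-++⁻ (row n t) ∈cells
... | inj₁ ∈row with refl , lt ← ∈-row⁻ {n} ∈row = lt , inj₁ ≤-refl
... | inj₂ ∈rest with ∈-++⁻ (diagonal n k t) ∈rest
...   | inj₁ ∈diag with k≤i , eq ← ∈-diagonal⁻ {n} {k} {t} ∈diag =
        ≤-trans (s≤s (m≤n+m _ t)) (≤-reflexive eq) , inj₂ (k≤i , ≤-reflexive (sym eq))
...   | inj₂ ∈tail with lt , short ← ∈-cells⁻ t ∈tail =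
        lt , Sum.map m≤n⇒m≤1+n (λ (k≤i , le) → k≤i , m≤n⇒m≤1+n le) short

-- Rows differ in `i`, diagonals in length, and `t ≤ k` separates rows, where `i < k`, from
-- diagonals, where `k ≤ i`.
cells-unique : ∀ {n k} t → t ≤ k → Unique (cells n k t)
cells-unique zero    _   = []
cells-unique {n} {k} (suc t) t<k =
  Unique.++⁺ (Unique.map⁺ (cong proj₂) (Unique.upTo⁺ (n ∸ t)))
    (Unique.++⁺ (Unique.map⁺ (cong proj₂) (Unique.upTo⁺ (n ∸ (t + k))))
      (cells-unique t (<⇒≤ t<k)) diagonal#cells)
    row#rest
  where
  diagonal#cells : ∀ {v} → ¬ (v ∈ˡ diagonal n k t × v ∈ˡ cells n k t)
  diagonal#cells (∈diag , ∈tail) with k≤i , eq ← ∈-diagonal⁻ {n} {k} {t} ∈diag | ∈-cells⁻ {n} {k} t ∈tail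
  ... | _ , inj₁ i<t      = <⇒≱ (<-trans i<t t<k) k≤i
  ... | _ , inj₂ (_ , le) = <⇒≱ (≤-reflexive eq) le
  row#rest : ∀ {v} → ¬ (v ∈ˡ row n t × v ∈ˡ diagonal n k t ++ cells n k t)
  row#rest (∈row , ∈rest) with refl , _ ← ∈-row⁻ {n} {t} ∈row | ∈-++⁻ (diagonal n k t) ∈rest
  ... | inj₁ ∈diag = <⇒≱ t<k (proj₁ (∈-diagonal⁻ {n} {k} {t} ∈diag))
  ... | inj₂ ∈tail with ∈-cells⁻ {n} {k} t ∈tail
  ...   | _ , inj₁ t<t       = <-irrefl refl t<t
  ...   | _ , inj₂ (k≤t , _) = <⇒≱ t<k k≤t

-- Step `t` adds `n - t` and `n - (t + k)` cells, exact differences because `2k ≤ n`. At `t = k` the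
-- correction on the left becomes `2k²`.
length-cells : ∀ {n k} t → t ≤ k → k + k ≤ n → length (cells n k t) + (t * t + t * k) ≡ 2 * t * n + t
length-cells zero    _ _ = refl
length-cells {n} {k} (suc t) t<k 2k≤n = begin
  length (row n t ++ diagonal n k t ++ cells n k t) + (suc t * suc t + suc t * k)
    ≡⟨ cong (_+ (suc t * suc t + suc t * k)) (trans (length-++ (row n t))
         (cong₂ _+_ (length-map-upTo _ (n ∸ t))
           (trans (length-++ (diagonal n k t)) (cong (_+ rest) (length-map-upTo _ (n ∸ (t + k))))))) ⟩
  (n ∸ t) + ((n ∸ (t + k)) + rest) + (suc t * suc t + suc t * k)
    ≡⟨ regroup t k (n ∸ t) (n ∸ (t + k)) rest ⟩
  (t + (n ∸ t)) + (t + k + (n ∸ (t + k))) + (rest + (t * t + t * k)) + 1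
    ≡⟨ cong (_+ 1) (cong₂ _+_ (cong₂ _+_ (m+[n∸m]≡n (≤-trans (m≤m+n t k) t+k≤n)) (m+[n∸m]≡n t+k≤n))
         (length-cells t (<⇒≤ t<k) 2k≤n)) ⟩
  n + n + (2 * t * n + t) + 1
    ≡⟨ total t n ⟩
  2 * suc t * n + suc t ∎
  where
  open ≡-Reasoning
  rest = length (cells n k t)
  t+k≤n : t + k ≤ n
  t+k≤n = ≤-trans (+-monoˡ-≤ k (<⇒≤ t<k)) 2k≤n
  regroup : ∀ t k u v l → u + (v + l) + (suc t * suc t + suc t * k) ≡ (t + u) + (t + k + v) + (l + (t * t + t * k)) + 1
  regroup = solve-∀
  total : ∀ t n → n + n + (2 * t * n + t) + 1 ≡ 2 * suc t * n + suc t
  total = solve-∀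

-- Colouring the segments through a point

segment-mono : ∀ {n i i′ c c′} → i ≤ i′ → c ≤ c′ → segment {n} i′ c′ ⊆ segment i c
segment-mono {i′ = i′} {c′ = c′} i≤i′ c≤c′ {x} x∈ with i′≤x , lt ← ∈-segment⁻ {i = i′} {c′} x∈ =
  ∈-segment⁺ (≤-trans i≤i′ i′≤x) (≤-trans (s≤s (+-monoʳ-≤ (toℕ x) c≤c′)) lt)

-- Cells of equal colour lie on a hook, hence the segments through x of one
-- colour form a chain.
colour : ℕ → ℕ → ℕ → ℕ → ℕ
colour n x i c = i ⊓ (n ∸ suc (x + c))

-- The common colour is at most `i < i′`, so for the second cell the minimum is its other argument;
-- comparing that with the first cell bounds `c`.
colour-row< : ∀ {n x i c i′ c′} → x + c < n → colour n x i c ≡ colour n x i′ c′ → i < i′ → c ≤ c′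
colour-row< {n} {x} {i} {c} {i′} {c′} x+c<n same i<i′ with ⊓-sel i′ (n ∸ suc (x + c′))
... | inj₁ ≡i′ = contradiction i<i′ (≤⇒≯ (≤-trans (≤-reflexive (trans (sym ≡i′) (sym same))) (m⊓n≤m i _)))
... | inj₂ ≡e′ = +-cancelˡ-≤ x _ _ (s≤s⁻¹ (∸-cancelʳ-≤ x+c<n
                   (≤-trans (≤-reflexive (trans (sym ≡e′) (sym same))) (m⊓n≤n i _))))

colour-comparable : ∀ {n x i c i′ c′} → x + c < n → x + c′ < n → colour n x i c ≡ colour n x i′ c′ →
  segment {n} i c ⊆ segment i′ c′ ⊎ segment {n} i′ c′ ⊆ segment i c
colour-comparable {n} {x} {i} {c} {i′} {c′} lt lt′ same with <-cmp i i′ | ≤-total c c′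
... | tri< i<i′ _ _ | _          = inj₂ (segment-mono (<⇒≤ i<i′) (colour-row< {i = i} lt same i<i′))
... | tri> _ _ i′<i | _          = inj₁ (segment-mono (<⇒≤ i′<i) (colour-row< {i = i′} lt′ (sym same) i′<i))
... | tri≈ _ refl _ | inj₁ c≤c′ = inj₂ (segment-mono (≤-refl {i}) c≤c′)
... | tri≈ _ refl _ | inj₂ c′≤c = inj₁ (segment-mono (≤-refl {i}) c′≤c)

module _ (n k : ℕ) where

  extremal : Family n
  extremal = family (⊥ ∷ map (λ (i , c) → segment i c) (cells n k k))
    (All.tabulate ⊥∉ ∷ Unique-map _ injective (cells-unique k ≤-refl))
    where
    injective : ∀ {v w} → v ∈ˡ cells n k k → w ∈ˡ cells n k k →
      segment {n} (proj₁ v) (proj₂ v) ≡ segment (proj₁ w) (proj₂ w) → v ≡ w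
    injective v∈ w∈ eq
      with refl , refl ← segment-injective (proj₁ (∈-cells⁻ {n} {k} k v∈)) (proj₁ (∈-cells⁻ {n} {k} k w∈)) eq = refl
    ⊥∉ : ∀ {U} → U ∈ˡ map (λ (i , c) → segment i c) (cells n k k) → ⊥ ≢ U
    ⊥∉ U∈ ⊥≡U with (i , c) , v∈ , refl ← ∈-map⁻ _ U∈ =
      -- An empty segment would be contained in `segment (suc i) c`.
      ⊈-segment-row {n} {i} {c} {suc i} {c} i+c<n ≤-refl λ x∈ → contradiction (subst (_ ∈ˢ_) (sym ⊥≡U) x∈) ∉⊥
      where i+c<n = proj₁ (∈-cells⁻ {n} {k} k v∈)

  extremal-segments : SegmentFamily extremal
  -- The cell `(n , 0)` encodes [n + 1 , n], which is empty.
  extremal-segments U (here refl) = subst IsSegment (empty-segment {n} {n} {0} (m≤m+n n 0)) (segment-IsSegment n 0)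
  extremal-segments U (there U∈) with (i , c) , _ , refl ← ∈-map⁻ _ U∈ = segment-IsSegment i c

  record Through (x : Fin n) (U : Subset n) : Set where
    field
      {i c}    : ℕ
      cell     : U ≡ segment i c
      x+c<n    : toℕ x + c < n
      colour<k : colour n (toℕ x) i c < k

  -- The colour is the minimum of the number of points before the segment and the number of its
  -- points after `x`. The first is below `k` in a row; the second is below `k` if the length is at
  -- most `k`.
  through : ∀ {x U} → U ∈ extremal × x ∈ˢ U → Through x U
  through (here refl , x∈) = contradiction x∈ ∉⊥
  through {x} (there U∈ , x∈) with (i , c) , v∈ , refl ← ∈-map⁻ _ U∈
    with i≤x , x+c<n ← ∈-segment⁻ {i = i} {c} x∈ = record { cell = refl ; x+c<n = x+c<n ; colour<k = colour<k }
    where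
    colour<k : colour n (toℕ x) i c < k
    colour<k with ∈-cells⁻ {n} {k} k v∈
    ... | _ , inj₁ i<k = ≤-<-trans (m⊓n≤m i _) i<k
    ... | _ , inj₂ (_ , n≤k+i+c) = ≤-<-trans (m⊓n≤n i _)
      (+-cancelʳ-≤ (toℕ x + c) _ _ (begin
        suc (n ∸ suc (toℕ x + c)) + (toℕ x + c) ≡⟨ +-suc (n ∸ suc (toℕ x + c)) (toℕ x + c) ⟨
        (n ∸ suc (toℕ x + c)) + suc (toℕ x + c) ≡⟨ m∸n+n≡m x+c<n ⟩
        n                                       ≤⟨ n≤k+i+c ⟩
        k + (i + c)                             ≤⟨ +-monoʳ-≤ k (+-monoˡ-≤ c i≤x) ⟩
        k + (toℕ x + c)                         ∎))
      where open ≤-Reasoning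

  -- Members through `x` of equal colour are comparable, so an antichain uses each of the `k`
  -- colours at most once.
  extremal-wide : LocallyWide k extremal
  extremal-wide x A A⊆ antichain = injective⇒≤ {f = λ p → fromℕ< (Through.colour<k (at p))} injective
    where
    at : ∀ p → Through x (lookup (members A) p)
    at p = through (A⊆ _ (∈-lookup p))

    injective : ∀ {p q} → fromℕ< (Through.colour<k (at p)) ≡ fromℕ< (Through.colour<k (at q)) → p ≡ q
    injective {p} {q} eq = Unique⇒lookup-injective (distinct A)
      ([ antichain _ _ (∈-lookup p) (∈-lookup q) , sym ∘ antichain _ _ (∈-lookup q) (∈-lookup p) ]′
        (subst₂ (λ U V → U ⊆ V ⊎ V ⊆ U) (sym P.cell) (sym Q.cell)
          (colour-comparable {i = P.i} {i′ = Q.i} P.x+c<n Q.x+c<n (fromℕ<-injective _ _ _ _ eq))))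
      where
      module P = Through (at p)
      module Q = Through (at q)

-- The closed formula and the theorem

bound-formula : ∀ k n {l} → k + k ≤ n → l + 2 * (k * k) ≡ 2 * k * n + k → suc l ≡ 2 * k * n ∸ 2 * k ^ 2 + k + 1
bound-formula k n {l} 2k≤n eq = begin
  suc l                                        ≡⟨ +-comm 1 l ⟩
  l + 1                                        ≡⟨ cong (_+ 1) (m+n∸n≡m l (2 * (k * k))) ⟨
  l + 2 * (k * k) ∸ 2 * (k * k) + 1            ≡⟨ cong (λ s → s ∸ 2 * (k * k) + 1) eq ⟩
  2 * k * n + k ∸ 2 * (k * k) + 1              ≡⟨ cong (_+ 1) (+-∸-comm k 2k²≤2kn) ⟩
  2 * k * n ∸ 2 * (k * k) + k + 1              ≡⟨ cong (λ s → 2 * k * n ∸ 2 * (k * s) + k + 1) (*-identityʳ k) ⟨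
  2 * k * n ∸ 2 * k ^ 2 + k + 1                ∎
  where
  open ≡-Reasoning
  -- This makes the truncated subtraction in the bound exact.
  2k²≤2kn : 2 * (k * k) ≤ 2 * k * n
  2k²≤2kn = ≤-trans (≤-reflexive (sym (*-assoc 2 k k))) (*-monoʳ-≤ (2 * k) (≤-trans (m≤m+n k k) 2k≤n))

theorem3p6p5 : ∀ (k n : ℕ) → n ≥ 2 * k →
    (∀ (F : Family n) → SegmentFamily F → LocallyWide k F →
    card F ≤ 2 * k * n ∸ 2 * k ^ 2 + k + 1)
    × (∃[ F ] (SegmentFamily {n} F × LocallyWide k F ×
    card F ≡ 2 * k * n ∸ 2 * k ^ 2 + k + 1))
theorem3p6p5 k n n≥2k = upper , extremal n k , extremal-segments n k , extremal-wide n k , size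
  where
  2k≤n : k + k ≤ n
  2k≤n = ≤-trans (≤-reflexive (cong (k +_) (sym (+-identityʳ k)))) n≥2k

  upper : ∀ (F : Family n) → SegmentFamily F → LocallyWide k F → card F ≤ 2 * k * n ∸ 2 * k ^ 2 + k + 1
  upper F segments wide = ≤-trans (card≤observables F segments wide)
    (≤-reflexive (bound-formula k n 2k≤n (length-boundary k 2k≤n)))

  double : ∀ k → 2 * (k * k) ≡ k * k + k * k
  double = solve-∀

  size : card (extremal n k) ≡ 2 * k * n ∸ 2 * k ^ 2 + k + 1
  size = trans (cong suc (length-map _ (cells n k k)))
    (bound-formula k n 2k≤n (trans (cong (length (cells n k k) +_) (double k)) (length-cells k ≤-refl 2k≤n)))
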